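{- Let $G$ be a finite simple graph with at least two vertices. The family $\mathcal{F}(G)$ of all induced $G$-free graphs is feasible if and only if $G$ is not isomorphic to any of the graphs $K_k$, $K_k\backslash K_2$, $\overline{K_k}$, $\overline{K_k\backslash K_2}$ with $k\geq 2$.
   Context: All graphs are finite and simple. A family $\mathcal{F}$ of graphs is called feasible if for every pair of integers $(n,m)$ with $n\geq 1$ and $0\leq m\leq\binom{n}{2}$ there is a graph in $\mathcal{F}$ having exactly $n$ vertices and exactly $m$ edges. A graph is induced $G$-free if it has no induced subgraph isomorphic to $G$; $\mathcal{F}(G)$ denotes the family of all induced $G$-free graphs. $K_k$ is the complete graph on $k$ vertices, $K_k\backslash K_2$ is the graph obtained from $K_k$ by deleting one edge (keeping all $k$ vertices), and $\overline{X}$ denotes the complement of the graph $X$. -}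

module Defs where

open import Data.Fin using (Fin; zero; suc; _<?_)
open import Data.Fin.Properties using (_≟_)
open import Data.Fin.Subset using (Subset; _∈_)
open import Data.List using (List; allFin; cartesianProduct; filter; length)
open import Data.Nat using (ℕ; _≤_; s≤s)
open import Data.Nat.Combinatorics using (_C_)
open import Data.Product using (Σ-syntax; ∃; _×_; _,_; proj₁; proj₂; swap)
open import Data.Sum using (_⊎_; inj₁; inj₂)
open import Function using (_∘_)
open import Function.Bundles using (_↔_; _⇔_; Inverse)
open import Level using (Level; 0ℓ)
open import Relation.Binary using (Rel; Decidable; Symmetric; Irreflexive)
open import Relation.Binary.PropositionalEquality using (_≡_; _≢_; refl; ≢-sym)
open import Relation.Nullary using (¬_)
open import Relation.Nullary.Decidable using (¬?; _×-dec_; _⊎-dec_)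

record SimpleGraph (V : Set) : Set₁ where
  field
    Adj    : Rel V 0ℓ
    adj?   : Decidable Adj
    symm   : Symmetric Adj
    irrefl : Irreflexive _≡_ Adj

open SimpleGraph public

Graph : ℕ → Set₁
Graph n = SimpleGraph (Fin n)

infix 4 _≅_

_≅_ : {V W : Set} → SimpleGraph V → SimpleGraph W → Set
_≅_ {V} {W} G H =
  Σ[ f ∈ V ↔ W ] (∀ u v → Adj G u v ⇔ Adj H (Inverse.to f u) (Inverse.to f v))

-- Each edge {i , j} is listed exactly once, as the pair with i < j.
edges : ∀ {n} → Graph n → List (Fin n × Fin n)
edges {n} G =
  filter (λ (i , j) → (i <? j) ×-dec adj? G i j)
         (cartesianProduct (allFin n) (allFin n))

edgeCount : ∀ {n} → Graph n → ℕ
edgeCount G = length (edges G)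

-- Membership proofs i ∈ S are unique, so Σ[ i ∈ Fin n ] (i ∈ S) has exactly
-- one element for each vertex in S.
induced : ∀ {n} → Graph n → (S : Subset n) → SimpleGraph (∃ (_∈ S))
induced H S = record
  { Adj    = λ u v → Adj H (proj₁ u) (proj₁ v)
  ; adj?   = λ u v → adj? H (proj₁ u) (proj₁ v)
  ; symm   = symm H
  ; irrefl = λ { refl → irrefl H refl }
  }

complete : ∀ k → Graph k
complete k = record
  { Adj    = _≢_
  ; adj?   = λ u v → ¬? (u ≟ v)
  ; symm   = ≢-sym
  ; irrefl = λ u≡v u≢v → u≢v u≡v
  }

complement : ∀ {n} → Graph n → Graph n
complement G = record
  { Adj    = λ u v → u ≢ v × ¬ Adj G u v
  ; adj?   = λ u v → ¬? (u ≟ v) ×-dec ¬? (adj? G u v)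
  ; symm   = λ (u≢v , ¬uv) → ≢-sym u≢v , ¬uv ∘ symm G
  ; irrefl = λ u≡v (u≢v , _) → u≢v u≡v
  }

deleteEdge : ∀ {n} → Graph n → Fin n → Fin n → Graph n
deleteEdge G a b = record
  { Adj    = λ u v → Adj G u v × ¬ (u ≡ a × v ≡ b ⊎ u ≡ b × v ≡ a)
  ; adj?   = λ u v → adj? G u v ×-dec
                     ¬? (((u ≟ a) ×-dec (v ≟ b)) ⊎-dec ((u ≟ b) ×-dec (v ≟ a)))
  ; symm   = λ (uv , ¬ab) → symm G uv , ¬ab ∘ flipEnds
  ; irrefl = λ u≡v (uv , _) → irrefl G u≡v uv
  }
  where
  flipEnds : ∀ {u v} → v ≡ a × u ≡ b ⊎ v ≡ b × u ≡ a →
                       u ≡ a × v ≡ b ⊎ u ≡ b × v ≡ a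
  flipEnds (inj₁ p) = inj₂ (swap p)
  flipEnds (inj₂ p) = inj₁ (swap p)

-- Up to isomorphism the choice of the deleted edge does not matter.
completeMinusEdge : ∀ {k} → 2 ≤ k → Graph k
completeMinusEdge (s≤s (s≤s _)) = deleteEdge (complete _) zero (suc zero)

Family : (ℓ : Level) → Set _
Family ℓ = ∀ {n} → Graph n → Set ℓ

Feasible : ∀ {ℓ} → Family ℓ → Set _
Feasible F =
  ∀ n m → 1 ≤ n → m ≤ n C 2 → Σ[ H ∈ Graph n ] (F H × edgeCount H ≡ m)

InducedFree : ∀ {k} → Graph k → Family 0ℓ
InducedFree G {n} H = ¬ (Σ[ S ∈ Subset n ] (G ≅ induced H S))

{-# OPTIONS --safe #-}
module Submission where

-- Complementing reduces everything to graphs without isolated vertices.  Every m ≤ C(n,2)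
-- with m > C(n-1,2) is the edge count on n vertices of both
--   * K_{n-1} plus a vertex of suitable degree, and
--   * a complete multipartite graph with parts of size at most 3: its t ≤ n-2 non-edges form
--     disjoint triangles and at most two further disjoint edges;
-- smaller m are reached from fewer vertices by adding isolated ones.  If the first family does
-- not avoid G, then G - v is a clique for some v; if the second does not avoid G either, then
-- non-adjacency in G is transitive, so v has at most one non-neighbour.

open import Data.Bool using (Bool; true; false; not; _∧_; if_then_else_)
open import Data.Empty using (⊥)
open import Data.Fin using (Fin; zero; suc; toℕ; _<?_)
open import Data.Fin.Permutation using (Permutation′; transpose; ↔⇒≡; _∘ₚ_; _⟨$⟩ʳ_)
open import Data.Fin.Properties using (_≟_; any?; all?; ¬∀⟶∃¬; suc-injective)
open import Data.Fin.Subset using (_∈_; ⊤)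
open import Data.Fin.Subset.Properties using (∈⊤)
open import Data.List using (cartesianProduct; filter; length; map; tabulate; _++_)
open import Data.List.Properties using (filter-++; length-++)
open import Data.Nat using (ℕ; zero; suc; _+_; _∸_; _≤_; _<_; _≤?_; z≤n; s≤s)
open import Data.Nat.Combinatorics using (_C_; nC1≡n; nCk+nC[k+1]≡[n+1]C[k+1])
open import Data.Nat.Properties as ℕ using (+-suc; +-cancelʳ-≡; m∸n≤m; m+[n∸m]≡n)
open import Data.Product using (Σ-syntax; ∃; ∃₂; _×_; _,_; proj₁; proj₂)
open import Data.Sum using (_⊎_; inj₁; inj₂; [_,_]′)
open import Data.Vec.Functional using (foldr)
open import Data.Vec.Properties.WithK using ([]=-irrelevant)
open import Function using (_∘_; id)
open import Function.Bundles using (_⇔_; _↔_; Equivalence; Inverse; mk⇔; mk↔ₛ′)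
open import Function.Construct.Composition using (_⇔-∘_; _↔-∘_)
open import Function.Construct.Identity using (↔-id; ⇔-id)
open import Function.Construct.Symmetry using (⇔-sym; ↔-sym)
open import Level using (0ℓ)
open import Relation.Binary.PropositionalEquality
  using (_≡_; _≢_; refl; sym; trans; cong; cong₂; subst; subst₂; ≢-sym; module ≡-Reasoning)
open import Relation.Nullary using (¬_; Dec; yes; no; does; contradiction)
open import Relation.Nullary.Decidable
  using (decidable-stable; dec-true; dec-false; ¬?; _×-dec_; _→-dec_)
open import Relation.Unary using (Pred; Decidable)
open import Defs

open Inverse using (to; from)

private
  variable
    n : ℕ

-- Counting pairs and edges

∑ : (Fin n → ℕ) → ℕ
∑ = foldr _+_ 0

count : (Fin n → Bool) → ℕ
count f = ∑ λ i → if f i then 1 else 0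

-- Reads only positions above the diagonal, splitting off the row of `zero`. Counts for graphs that
-- grow by a new vertex `zero` therefore unfold by computation.
pairs : (Fin n → Fin n → Bool) → ℕ
pairs {zero}  f = 0
pairs {suc n} f = count (λ j → f zero (suc j)) + pairs (λ i j → f (suc i) (suc j))

∑-cong : {f g : Fin n → ℕ} → (∀ i → f i ≡ g i) → ∑ f ≡ ∑ g
∑-cong {zero}  h = refl
∑-cong {suc n} h = cong₂ _+_ (h zero) (∑-cong (h ∘ suc))

count-cong : {f g : Fin n → Bool} → (∀ i → f i ≡ g i) → count f ≡ count g
count-cong h = ∑-cong λ i → cong (if_then 1 else 0) (h i)

-- The diagonal is never read by `pairs`, and it is exactly where adjacency in `complement G`
-- differs from the negated adjacency of `G`.
pairs-cong : {f g : Fin n → Fin n → Bool} →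
             (∀ i j → i ≢ j → f i j ≡ g i j) → pairs f ≡ pairs g
pairs-cong {zero}  h = refl
pairs-cong {suc n} h =
  cong₂ _+_ (count-cong λ j → h zero (suc j) λ ())
            (pairs-cong λ i j i≢j → h (suc i) (suc j) (i≢j ∘ suc-injective))

module _ {A B : Set} {P : Pred (A × B) 0ℓ} (P? : Decidable P) where

  length-filter-row : ∀ {l} x (g : Fin l → B) →
    length (filter P? (map (x ,_) (tabulate g))) ≡ count (λ j → does (P? (x , g j)))
  length-filter-row {zero}  x g = refl
  length-filter-row {suc l} x g with does (P? (x , g zero))
  ... | true  = cong suc (length-filter-row x (g ∘ suc))
  ... | false = length-filter-row x (g ∘ suc)

  length-filter-product : ∀ {k l} (f : Fin k → A) (g : Fin l → B) →
    length (filter P? (cartesianProduct (tabulate f) (tabulate g)))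
      ≡ ∑ (λ i → count λ j → does (P? (f i , g j)))
  length-filter-product {zero}  f g = refl
  length-filter-product {suc k} f g = begin
    length (filter P? (row ++ rest))                   ≡⟨ cong length (filter-++ P? row rest) ⟩
    length (filter P? row ++ filter P? rest)           ≡⟨ length-++ (filter P? row) ⟩
    length (filter P? row) + length (filter P? rest)
      ≡⟨ cong₂ _+_ (length-filter-row (f zero) g) (length-filter-product (f ∘ suc) g) ⟩
    _ ∎
    where
    open ≡-Reasoning
    row  = map (f zero ,_) (tabulate g)
    rest = cartesianProduct (tabulate (f ∘ suc)) (tabulate g)

pairs≡∑ : (f : Fin n → Fin n → Bool) →
          ∑ (λ i → count λ j → does (i <? j) ∧ f i j) ≡ pairs f
pairs≡∑ {zero}  f = refl
pairs≡∑ {suc n} f =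
  cong (count (λ j → f zero (suc j)) +_) (pairs≡∑ λ i j → f (suc i) (suc j))

adjᵇ : Graph n → Fin n → Fin n → Bool
adjᵇ G i j = does (adj? G i j)

edgeCount≡pairs : (G : Graph n) → edgeCount G ≡ pairs (adjᵇ G)
edgeCount≡pairs G =
  trans (length-filter-product (λ (i , j) → (i <? j) ×-dec adj? G i j) id id) (pairs≡∑ (adjᵇ G))

[1+n]C2≡n+nC2 : ∀ n → suc n C 2 ≡ n + n C 2
[1+n]C2≡n+nC2 n = trans (sym (nCk+nC[k+1]≡[n+1]C[k+1] n 1)) (cong (_+ n C 2) (nC1≡n n))

count-not : (f : Fin n → Bool) → count (not ∘ f) + count f ≡ n
count-not {zero}  f = refl
count-not {suc n} f with f zero
... | true  = trans (+-suc _ _) (cong suc (count-not (f ∘ suc)))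
... | false = cong suc (count-not (f ∘ suc))

pairs-not : (f : Fin n → Fin n → Bool) →
            pairs (λ i j → not (f i j)) + pairs f ≡ n C 2
pairs-not {zero}  f = refl
pairs-not {suc n} f = begin
  (c′ + p′) + (c + p)  ≡⟨ interchange c′ p′ c p ⟩
  (c′ + c) + (p′ + p)
    ≡⟨ cong₂ _+_ (count-not λ j → f zero (suc j)) (pairs-not λ i j → f (suc i) (suc j)) ⟩
  n + n C 2            ≡⟨ [1+n]C2≡n+nC2 n ⟨
  suc n C 2            ∎
  where
  open ≡-Reasoning
  open import Algebra.Properties.CommutativeSemigroup ℕ.+-commutativeSemigroup using (interchange)
  c′ = count (λ j → not (f zero (suc j)))
  p′ = pairs (λ i j → not (f (suc i) (suc j)))
  c  = count (λ j → f zero (suc j))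
  p  = pairs (λ i j → f (suc i) (suc j))

edgeCount-complement : (G : Graph n) → edgeCount (complement G) + edgeCount G ≡ n C 2
edgeCount-complement {n} G = begin
  edgeCount (complement G) + edgeCount G
    ≡⟨ cong₂ _+_ (edgeCount≡pairs (complement G)) (edgeCount≡pairs G) ⟩
  pairs (adjᵇ (complement G)) + pairs (adjᵇ G)
    ≡⟨ cong (_+ pairs (adjᵇ G)) (pairs-cong offDiagonal) ⟩
  pairs (λ i j → not (adjᵇ G i j)) + pairs (adjᵇ G)
    ≡⟨ pairs-not (adjᵇ G) ⟩
  n C 2 ∎
  where
  open ≡-Reasoning
  offDiagonal : ∀ i j → i ≢ j → adjᵇ (complement G) i j ≡ not (adjᵇ G i j)
  offDiagonal i j i≢j rewrite dec-false (i ≟ j) i≢j = refl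

-- Graphs with no edge or a single edge

count≡0 : (f : Fin n → Bool) → count f ≡ 0 → ∀ i → f i ≢ true
count≡0 {suc n} f eq with f zero in f0
... | false = λ where
  zero    fi → contradiction (trans (sym fi) f0) λ ()
  (suc i) fi → count≡0 (f ∘ suc) eq i fi

count≡1 : (f : Fin n → Bool) → count f ≡ 1 →
          ∃ λ a → f a ≡ true × (∀ i → f i ≡ true → i ≡ a)
count≡1 {suc n} f eq with f zero in f0
... | true  = zero , f0 , λ where
  zero    _  → refl
  (suc i) fi → contradiction fi (count≡0 (f ∘ suc) (ℕ.suc-injective eq) i)
... | false with a , fa , uniq ← count≡1 (f ∘ suc) eq = suc a , fa , λ where
  zero    fi → contradiction (trans (sym fi) f0) λ ()
  (suc i) fi → cong suc (uniq i fi)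

Symm : (Fin n → Fin n → Bool) → Set
Symm f = ∀ i j → f i j ≡ true → f j i ≡ true

-- Only entries above the diagonal are counted; symmetry carries the conclusion to those below.
pairs≡0 : (f : Fin n → Fin n → Bool) → Symm f → pairs f ≡ 0 →
          ∀ i j → i ≢ j → f i j ≢ true
pairs≡0 {suc n} f fs eq = λ where
    zero    zero    i≢j _  → i≢j refl
    zero    (suc j) _   fj → row0 j fj
    (suc i) zero    _   fi → row0 i (fs _ _ fi)
    (suc i) (suc j) i≢j    →
      pairs≡0 (λ i j → f (suc i) (suc j)) (λ i j → fs (suc i) (suc j))
              (ℕ.m+n≡0⇒n≡0 (count (λ j → f zero (suc j))) eq) i j (i≢j ∘ cong suc)
  where
  row0 = count≡0 (λ j → f zero (suc j)) (ℕ.m+n≡0⇒m≡0 _ eq)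

SamePair : (a b u v : Fin n) → Set
SamePair a b u v = u ≡ a × v ≡ b ⊎ u ≡ b × v ≡ a

-- The single pair lies either in the row of `zero`, where `count≡1` finds its other end, or among
-- the remaining vertices, where induction applies.
pairs≡1 : (f : Fin n → Fin n → Bool) → Symm f → pairs f ≡ 1 →
          ∃₂ λ a b → a ≢ b × f a b ≡ true ×
            (∀ i j → i ≢ j → f i j ≡ true → SamePair a b i j)
pairs≡1 {suc n} f fs eq with count (λ j → f zero (suc j)) in c
... | 0
  with a , b , a≢b , fab , uniq ←
    pairs≡1 (λ i j → f (suc i) (suc j)) (λ i j → fs (suc i) (suc j)) eq
  = suc a , suc b , a≢b ∘ suc-injective , fab , λ where
    zero    zero    i≢j _  → contradiction refl i≢j
    zero    (suc j) _   fj → contradiction fj (count≡0 _ c j)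
    (suc i) zero    _   fi → contradiction (fs _ _ fi) (count≡0 _ c i)
    (suc i) (suc j) i≢j fij → lift (uniq i j (i≢j ∘ cong suc) fij)
  where
  lift : ∀ {a b i j} → SamePair a b i j → SamePair (Fin.suc a) (suc b) (suc i) (suc j)
  lift (inj₁ (refl , refl)) = inj₁ (refl , refl)
  lift (inj₂ (refl , refl)) = inj₂ (refl , refl)
... | 1
  with b , fb , uniq ← count≡1 (λ j → f zero (suc j)) c
  = zero , suc b , (λ ()) , fb , λ where
    zero    zero    i≢j _  → contradiction refl i≢j
    zero    (suc j) _   fj → inj₁ (refl , cong suc (uniq j fj))
    (suc i) zero    _   fi → inj₂ (cong suc (uniq i (fs _ _ fi)) , refl)
    (suc i) (suc j) i≢j fij → contradiction fij
      (pairs≡0 (λ i j → f (suc i) (suc j)) (λ i j → fs (suc i) (suc j))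
               (ℕ.suc-injective eq) i j (i≢j ∘ cong suc))

adjᵇ-symm : (G : Graph n) → Symm (adjᵇ G)
adjᵇ-symm G i j h with adj? G i j
... | yes p = dec-true (adj? G j i) (symm G p)

does⇒ : ∀ {A : Set} (A? : Dec A) → does A? ≡ true → A
does⇒ (yes a) _ = a

edgeless : (G : Graph n) → edgeCount G ≡ 0 → ∀ i j → ¬ Adj G i j
edgeless G eq i j Gij =
  pairs≡0 (adjᵇ G) (adjᵇ-symm G) (trans (sym (edgeCount≡pairs G)) eq) i j
          (λ i≡j → irrefl G i≡j Gij) (dec-true (adj? G i j) Gij)

oneEdge : (G : Graph n) → edgeCount G ≡ 1 →
          ∃₂ λ a b → a ≢ b × (∀ i j → Adj G i j ⇔ SamePair a b i j)
oneEdge G eq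
  with a , b , a≢b , fab , uniq ←
    pairs≡1 (adjᵇ G) (adjᵇ-symm G) (trans (sym (edgeCount≡pairs G)) eq)
  = a , b , a≢b , λ i j → mk⇔
    (λ Gij → uniq i j (λ i≡j → irrefl G i≡j Gij) (dec-true (adj? G i j) Gij))
    (λ where
      (inj₁ (refl , refl)) → does⇒ (adj? G a b) fab
      (inj₂ (refl , refl)) → symm G (does⇒ (adj? G a b) fab))

-- Isomorphisms and complements

private
  variable
    U V W : Set

↔-injective : (f : V ↔ W) {u v : V} → to f u ≡ to f v → u ≡ v
↔-injective f {u} {v} eq =
  trans (sym (Inverse.strictlyInverseʳ f u)) (trans (cong (from f) eq) (Inverse.strictlyInverseʳ f v))

≅-sym : (G : SimpleGraph V) (H : SimpleGraph W) → G ≅ H → H ≅ G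
≅-sym G H (f , f-adj) = ↔-sym f , λ u v →
  ⇔-sym (f-adj (from f u) (from f v)) ⇔-∘
  mk⇔ (subst₂ (Adj H) (sym (Inverse.strictlyInverseˡ f u)) (sym (Inverse.strictlyInverseˡ f v)))
      (subst₂ (Adj H) (Inverse.strictlyInverseˡ f u) (Inverse.strictlyInverseˡ f v))

≅-trans : (G : SimpleGraph U) (H : SimpleGraph V) (K : SimpleGraph W) →
          G ≅ H → H ≅ K → G ≅ K
≅-trans G H K (f , f-adj) (g , g-adj) =
  g ↔-∘ f , λ u v → g-adj (to f u) (to f v) ⇔-∘ f-adj u v

induced-⊤ : (H : Graph n) → H ≅ induced H ⊤
induced-⊤ H =
  mk↔ₛ′ (_, ∈⊤) proj₁ (λ (i , i∈) → cong (i ,_) ([]=-irrelevant ∈⊤ i∈)) (λ _ → refl) ,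
  λ u v → ⇔-id _

free⇒≇ : (G H : Graph n) → InducedFree G H → ¬ (G ≅ H)
free⇒≇ G H free G≅H = free (⊤ , ≅-trans G H (induced H ⊤) G≅H (induced-⊤ H))

-- The vertex map of an induced copy, freed from the subset and its membership proofs. Freeness is a
-- negation, so it is proved by refuting such embeddings.
record _↪_ {k n} (G : Graph k) (H : Graph n) : Set where
  field
    emb       : Fin k → Fin n
    injective : ∀ {u v} → emb u ≡ emb v → u ≡ v
    adj       : ∀ u v → Adj G u v ⇔ Adj H (emb u) (emb v)

open _↪_

copy⇒↪ : ∀ {k} (G : Graph k) (H : Graph n) {S} → G ≅ induced H S → G ↪ H
copy⇒↪ G H (f , f-adj) = record
  { emb       = proj₁ ∘ to f
  ; injective = λ eq → ↔-injective f (∃∈-≡ eq)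
  ; adj       = f-adj
  }
  where
  ∃∈-≡ : ∀ {S} {p q : ∃ (_∈ S)} → proj₁ p ≡ proj₁ q → p ≡ q
  ∃∈-≡ {p = i , i∈} {q = .i , i∈′} refl = cong (i ,_) ([]=-irrelevant i∈ i∈′)

-- Adjacency is decidable, hence stable under double negation, so an edge is recovered by refuting
-- the complementary one. Injectivity matches the distinctness conditions.
complement-reflects-adj : ∀ {k} (G : Graph k) (H : Graph n) (f : Fin k → Fin n) →
  (∀ {u v} → f u ≡ f v → u ≡ v) →
  (∀ u v → Adj (complement G) u v ⇔ Adj (complement H) (f u) (f v)) →
  ∀ u v → Adj G u v ⇔ Adj H (f u) (f v)
complement-reflects-adj G H f f-inj f-adj u v = mk⇔
  (λ Guv → decidable-stable (adj? H (f u) (f v)) λ ¬Huv →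
    proj₂ (Equivalence.from (f-adj u v) ((λ eq → irrefl G (f-inj eq) Guv) , ¬Huv)) Guv)
  (λ Huv → decidable-stable (adj? G u v) λ ¬Guv →
    proj₂ (Equivalence.to (f-adj u v) ((λ eq → irrefl H (cong f eq) Huv) , ¬Guv)) Huv)

complement-cong : ∀ {k} (G : Graph k) (H : Graph n) → G ≅ H → complement G ≅ complement H
complement-cong G H (f , f-adj) = f , λ u v → mk⇔
  (λ (u≢v , ¬Guv) → u≢v ∘ ↔-injective f , ¬Guv ∘ Equivalence.from (f-adj u v))
  (λ (u≢v , ¬Huv) → u≢v ∘ cong (to f) , ¬Huv ∘ Equivalence.to (f-adj u v))

complement-involutive : (G : Graph n) → complement (complement G) ≅ G
complement-involutive G = ↔-id _ , λ u v → mk⇔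
  (λ (u≢v , ¬Ḡuv) → decidable-stable (adj? G u v) λ ¬Guv → ¬Ḡuv (u≢v , ¬Guv))
  (λ Guv → (λ u≡v → irrefl G u≡v Guv) , λ Ḡuv → proj₂ Ḡuv Guv)

complement-free : ∀ {k} (G : Graph k) (H : Graph n) →
                  InducedFree G H → InducedFree (complement G) (complement H)
complement-free G H free (S , iso@(f , _)) =
  free (S , f , complement-reflects-adj G H (emb e) (injective e) (adj e))
  where e = copy⇒↪ (complement G) (complement H) iso

≅-free : ∀ {k l} (G : Graph k) (G′ : Graph l) (H : Graph n) →
         G ≅ G′ → InducedFree G H → InducedFree G′ H
≅-free G G′ H G≅G′ free (S , iso) = free (S , ≅-trans G G′ (induced H S) G≅G′ iso)

feasible-mono : {P Q : Family 0ℓ} → (∀ {n} (H : Graph n) → P H → Q H) →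
                Feasible P → Feasible Q
feasible-mono P⊆Q feas n m 1≤n m≤ with H , PH , eq ← feas n m 1≤n m≤ = H , P⊆Q H PH , eq

-- Asks feasibility for `n C 2 ∸ m` edges. Prescribing the missing edges serves closure under
-- complement as well as the exclusions, where `m` is `0` or `1`.
withComplementEdges : ∀ {k} (G : Graph k) → Feasible (InducedFree G) →
  ∀ n m → 1 ≤ n → m ≤ n C 2 →
  Σ[ H ∈ Graph n ] (InducedFree G H × edgeCount (complement H) ≡ m)
withComplementEdges G feas n m 1≤n m≤nC2
  with H , free , eq ← feas n (n C 2 ∸ m) 1≤n (m∸n≤m (n C 2) m) =
  H , free , +-cancelʳ-≡ (edgeCount H) _ _ (begin
    edgeCount (complement H) + edgeCount H ≡⟨ edgeCount-complement H ⟩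
    n C 2                                  ≡⟨ m+[n∸m]≡n m≤nC2 ⟨
    m + (n C 2 ∸ m)                        ≡⟨ cong (m +_) eq ⟨
    m + edgeCount H                        ∎)
  where open ≡-Reasoning

feasible-complement : ∀ {k} (G : Graph k) →
                      Feasible (InducedFree G) → Feasible (InducedFree (complement G))
feasible-complement G feas n m 1≤n m≤nC2
  with H , free , eq ← withComplementEdges G feas n m 1≤n m≤nC2 =
  complement H , complement-free G H free , eq

-- The double complement is identified with `G` by an isomorphism, along which freeness is
-- transported.
feasible-uncomplement : ∀ {k} (G : Graph k) →
                        Feasible (InducedFree (complement G)) → Feasible (InducedFree G)
feasible-uncomplement G =
  feasible-mono (λ H → ≅-free (complement (complement G)) G H (complement-involutive G)) ∘
  feasible-complement (complement G)

-- Complete graphs and complete graphs minus an edge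

-- Every permutation is an automorphism of the complete graph, so it only moves the deleted edge.
deleteEdge-permute : (π : Permutation′ n) (a b : Fin n) →
  deleteEdge (complete n) a b ≅ deleteEdge (complete n) (π ⟨$⟩ʳ a) (π ⟨$⟩ʳ b)
deleteEdge-permute π a b = π , λ u v → mk⇔
  (λ (u≢v , ¬ab) → u≢v ∘ π-inj , λ where
    (inj₁ (p , q)) → ¬ab (inj₁ (π-inj p , π-inj q))
    (inj₂ (p , q)) → ¬ab (inj₂ (π-inj p , π-inj q)))
  (λ (u≢v , ¬ab) → u≢v ∘ cong (to π) , λ where
    (inj₁ (refl , refl)) → ¬ab (inj₁ (refl , refl))
    (inj₂ (refl , refl)) → ¬ab (inj₂ (refl , refl)))
  where
  π-inj : ∀ {u v} → to π u ≡ to π v → u ≡ v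
  π-inj = ↔-injective π

transpose-first : (i j : Fin n) → transpose i j ⟨$⟩ʳ i ≡ j
transpose-first i j rewrite dec-true (i ≟ i) refl = refl

transpose-other : (i j k : Fin n) → k ≢ i → k ≢ j → transpose i j ⟨$⟩ʳ k ≡ k
transpose-other i j k k≢i k≢j rewrite dec-false (k ≟ i) k≢i | dec-false (k ≟ j) k≢j = refl

deleteEdge≅completeMinusEdge : (2≤n : 2 ≤ n) {a b : Fin n} → a ≢ b →
                               deleteEdge (complete n) a b ≅ completeMinusEdge 2≤n
deleteEdge≅completeMinusEdge {suc (suc n)} (s≤s (s≤s _)) {a} {b} a≢b =
  subst₂ (λ x y → deleteEdge (complete _) a b ≅ deleteEdge (complete _) x y)
         πa≡0 πb≡1 (deleteEdge-permute (σ ∘ₚ τ) a b)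
  where
  σ = transpose a zero
  -- `σ` may move `b`, so `τ` has to act on the image `b′`. As `b′` differs from `zero`, `τ` keeps
  -- the end already placed there.
  b′ = σ ⟨$⟩ʳ b
  τ = transpose b′ (suc zero)
  0≢b′ : zero ≢ b′
  0≢b′ eq = a≢b (↔-injective σ (trans (transpose-first a zero) eq))
  πa≡0 : (σ ∘ₚ τ) ⟨$⟩ʳ a ≡ zero
  πa≡0 = trans (cong (τ ⟨$⟩ʳ_) (transpose-first a zero))
               (transpose-other b′ (suc zero) zero 0≢b′ λ ())
  πb≡1 : (σ ∘ₚ τ) ⟨$⟩ʳ b ≡ suc zero
  πb≡1 = transpose-first b′ (suc zero)

complement-edgeless : (H : Graph n) → edgeCount (complement H) ≡ 0 → H ≅ complete n
complement-edgeless H eq = ↔-id _ , λ u v → mk⇔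
  (λ Huv u≡v → irrefl H u≡v Huv)
  (λ u≢v → decidable-stable (adj? H u v) λ ¬Huv →
    edgeless (complement H) eq u v (u≢v , ¬Huv))

complement-oneEdge : (2≤n : 2 ≤ n) (H : Graph n) →
                     edgeCount (complement H) ≡ 1 → H ≅ completeMinusEdge 2≤n
complement-oneEdge 2≤n H eq with a , b , a≢b , pair ← oneEdge (complement H) eq =
  ≅-trans H (deleteEdge (complete _) a b) (completeMinusEdge 2≤n) (↔-id _ , λ u v → mk⇔
    (λ Huv → (λ u≡v → irrefl H u≡v Huv) ,
             λ ab → proj₂ (Equivalence.from (pair u v) ab) Huv)
    (λ (u≢v , ¬ab) → decidable-stable (adj? H u v) λ ¬Huv →
      ¬ab (Equivalence.to (pair u v) (u≢v , ¬Huv))))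
    (deleteEdge≅completeMinusEdge 2≤n a≢b)

-- With no missing edge only the complete graph remains, so feasibility on `n` vertices yields a
-- `G`-free graph that would be isomorphic to `G`.
feasible⇒≇complete : (G : Graph n) → 2 ≤ n → Feasible (InducedFree G) →
                     ∀ k → ¬ (G ≅ complete k)
feasible⇒≇complete G 2≤n feas k iso with refl ← ↔⇒≡ (proj₁ iso)
  with H , free , eq ← withComplementEdges G feas _ 0 (ℕ.<⇒≤ 2≤n) z≤n =
  free⇒≇ G H free (≅-trans G (complete k) H iso
    (≅-sym H (complete k) (complement-edgeless H eq)))

1≤nC2 : 2 ≤ n → 1 ≤ n C 2
1≤nC2 {suc (suc n)} (s≤s (s≤s _)) =
  subst (1 ≤_) (sym ([1+n]C2≡n+nC2 (suc n))) (s≤s z≤n)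

-- The same argument with one missing edge, whose position does not matter up to isomorphism.
feasible⇒≇completeMinusEdge : (G : Graph n) → Feasible (InducedFree G) →
  ∀ k (2≤k : 2 ≤ k) → ¬ (G ≅ completeMinusEdge 2≤k)
feasible⇒≇completeMinusEdge G feas k 2≤k iso with refl ← ↔⇒≡ (proj₁ iso)
  with H , free , eq ← withComplementEdges G feas _ 1 (ℕ.<⇒≤ 2≤k) (1≤nC2 2≤k) =
  free⇒≇ G H free (≅-trans G (completeMinusEdge 2≤k) H iso
    (≅-sym H (completeMinusEdge 2≤k) (complement-oneEdge 2≤k H eq)))

-- Feasible families closed under adding isolated vertices

-- Serves two purposes: `attach 0` adds an isolated vertex, and `attach s (complete n)` with `s ≤ n`
-- is a clique with a further vertex of degree `s`.
attach : ℕ → Graph n → Graph (suc n)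
attach s H = record { Adj = A ; adj? = A? ; symm = λ {u} {v} → A-sym u v ; irrefl = λ {u} → A-irrefl u }
  where
  A : Fin (suc _) → Fin (suc _) → Set
  A zero    zero    = ⊥
  A zero    (suc j) = toℕ j < s
  A (suc i) zero    = toℕ i < s
  A (suc i) (suc j) = Adj H i j
  A? : ∀ u v → Dec (A u v)
  A? zero    zero    = no λ ()
  A? zero    (suc j) = toℕ j ℕ.<? s
  A? (suc i) zero    = toℕ i ℕ.<? s
  A? (suc i) (suc j) = adj? H i j
  A-sym : ∀ u v → A u v → A v u
  A-sym zero    zero    ()
  A-sym zero    (suc j) p = p
  A-sym (suc i) zero    p = p
  A-sym (suc i) (suc j) p = symm H p
  A-irrefl : ∀ u {v} → u ≡ v → ¬ A u v
  A-irrefl zero    refl ()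
  A-irrefl (suc i) refl p = irrefl H refl p

count-< : ∀ {s} → s ≤ n → count {n} (λ j → does (toℕ j ℕ.<? s)) ≡ s
count-< {zero}  z≤n       = refl
count-< {suc n} z≤n       = count-< {n} z≤n
count-< {suc n} (s≤s s≤n) = cong suc (count-< s≤n)

edgeCount-attach : ∀ {s} → s ≤ n → (H : Graph n) → edgeCount (attach s H) ≡ s + edgeCount H
edgeCount-attach {n} {s} s≤n H = begin
  edgeCount (attach s H)      ≡⟨ edgeCount≡pairs (attach s H) ⟩
  count {n} (λ j → does (toℕ j ℕ.<? s)) + pairs (adjᵇ H)
    ≡⟨ cong₂ _+_ (count-< s≤n) (sym (edgeCount≡pairs H)) ⟩
  s + edgeCount H             ∎
  where open ≡-Reasoning

edgeCount-complete : ∀ n → edgeCount (complete n) ≡ n C 2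
edgeCount-complete zero    = refl
edgeCount-complete (suc n) = begin
  edgeCount (complete (suc n))  ≡⟨ edgeCount≡pairs (complete (suc n)) ⟩
  count {n} (λ _ → true) + pairs (adjᵇ (complete n))
    ≡⟨ cong₂ _+_ (count-true n) (trans (sym (edgeCount≡pairs (complete n))) (edgeCount-complete n)) ⟩
  n + n C 2                     ≡⟨ [1+n]C2≡n+nC2 n ⟨
  suc n C 2                     ∎
  where
  open ≡-Reasoning
  count-true : ∀ n → count {n} (λ _ → true) ≡ n
  count-true zero    = refl
  count-true (suc n) = cong suc (count-true n)

module _ (P : Family 0ℓ)
  (point    : P (complete 1))
  (isolated : ∀ {n} {H : Graph n} → P H → P (attach 0 H))
  -- m = s + n C 2 ranges over n C 2 < m ≤ suc n C 2, and t is the number of missing edges.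
  (dense    : ∀ n s t → 1 ≤ s → s + t ≡ n →
              Σ[ H ∈ Graph (suc n) ] (P H × edgeCount H ≡ s + n C 2))
  where

  feasible-closedUnderIsolated : Feasible P
  feasible-closedUnderIsolated (suc n) m _ m≤ = go n m m≤
    where
    go : ∀ n m → m ≤ suc n C 2 → Σ[ H ∈ Graph (suc n) ] (P H × edgeCount H ≡ m)
    go zero    zero z≤n = complete 1 , point , refl
    go (suc n) m    m≤ with m ≤? suc n C 2
    ... | yes m≤′ with H , PH , eq ← go n m m≤′ =
      attach 0 H , isolated PH , trans (edgeCount-attach z≤n H) eq
    ... | no m≰ = overfull (ℕ.≰⇒> m≰)
      where
      k = suc n C 2
      -- The excess of `m` over `suc n C 2`: positive in this branch, and at most `suc n` by
      -- Pascal's rule, hence in the range of `dense`.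
      s = m ∸ k
      s≤ : s ≤ suc n
      s≤ = ℕ.m≤n+o⇒m∸n≤o m k
        (subst (m ≤_) (trans ([1+n]C2≡n+nC2 (suc n)) (ℕ.+-comm (suc n) k)) m≤)
      overfull : k < m → Σ[ H ∈ Graph (suc (suc n)) ] (P H × edgeCount H ≡ m)
      overfull k<m
        with H , PH , eq ← dense (suc n) s (suc n ∸ s) (ℕ.m<n⇒0<n∸m k<m) (m+[n∸m]≡n s≤) =
        H , PH , trans eq (ℕ.m∸n+n≡m (ℕ.<⇒≤ k<m))

-- A clique, one further vertex, and isolated vertices

CliqueOff : Fin n → Graph n → Set
CliqueOff v H = ∀ x y → x ≢ v → y ≢ v → x ≢ y → Adj H x y

-- The non-isolated vertices other than `w` form a clique; `x′` and `y′` witness that `x` and `y`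
-- are not isolated. In this form the property survives adding isolated vertices.
NearClique : Family 0ℓ
NearClique {n} H = Σ[ w ∈ Fin n ]
  (∀ x y x′ y′ → x ≢ w → y ≢ w → x ≢ y → Adj H x x′ → Adj H y y′ → Adj H x y)

nearClique-feasible : Feasible NearClique
nearClique-feasible = feasible-closedUnderIsolated NearClique point isolated dense
  where
  point : NearClique (complete 1)
  point = zero , λ x y _ _ _ _ x≢y _ _ → x≢y

  isolated : ∀ {n} {H : Graph n} → NearClique H → NearClique (attach 0 H)
  isolated (w , h) = suc w , λ where
    zero    _       (suc _) _       _   _   _   () _
    (suc _) zero    _       (suc _) _   _   _   _  ()
    (suc x) (suc y) (suc x′) (suc y′) x≢w y≢w x≢y xx′ yy′ →
      h x y x′ y′ (x≢w ∘ cong suc) (y≢w ∘ cong suc) (x≢y ∘ cong suc) xx′ yy′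

  dense : ∀ n s t → 1 ≤ s → s + t ≡ n →
          Σ[ H ∈ Graph (suc n) ] (NearClique H × edgeCount H ≡ s + n C 2)
  dense n s t _ s+t≡n = attach s (complete n) ,
    (zero , λ where
      zero    _       _ _ 0≢0 _   _   _ _ → contradiction refl 0≢0
      (suc x) zero    _ _ _   0≢0 _   _ _ → contradiction refl 0≢0
      (suc x) (suc y) _ _ _   _   x≢y _ _ → x≢y ∘ cong suc) ,
    trans (edgeCount-attach (subst (s ≤_) s+t≡n (ℕ.m≤m+n s t)) (complete n))
          (cong (s +_) (edgeCount-complete n))

NoIsolated : Graph n → Set
NoIsolated {n} G = ∀ v → Σ[ w ∈ Fin n ] Adj G v w

-- Every vertex of a copy of `G` has a neighbour inside the copy, so the vertices not sent to `w`
-- are pairwise adjacent. Removing the one over `w` would leave a clique in `G`.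
nearClique⇒free : (G : Graph (suc n)) → NoIsolated G → ¬ (∃ λ v → CliqueOff v G) →
                  ∀ {l} (H : Graph l) → NearClique H → InducedFree G H
nearClique⇒free G nbr noClique H (w , h) (S , iso) = noClique (special , λ x y x≢ y≢ x≢y →
    Equivalence.from (adj e x y)
      (h _ _ _ _ (special-avoids x x≢) (special-avoids y y≢) (x≢y ∘ injective e)
         (Equivalence.to (adj e x _) (proj₂ (nbr x))) (Equivalence.to (adj e y _) (proj₂ (nbr y)))))
  where
  e = copy⇒↪ G H iso
  w∈? : Dec (∃ λ v → emb e v ≡ w)
  w∈? = any? λ v → emb e v ≟ w
  special : Fin _
  special with w∈?
  ... | yes (v , _) = v
  -- If the copy misses `w`, all its vertices are pairwise adjacent and any default works.
  ... | no _        = zero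
  special-avoids : ∀ x → x ≢ special → emb e x ≢ w
  special-avoids x x≢ fx≡w with w∈?
  ... | yes (v , fv≡w) = x≢ (injective e (trans fx≡w (sym fv≡w)))
  ... | no w∉          = w∉ (x , fx≡w)

-- Complete multipartite graphs and isolated vertices

-- Excludes the paw (a triangle with a pendant edge) as an induced subgraph.
NearMultipartite : Family 0ℓ
NearMultipartite H = ∀ x y z y′ → Adj H y y′ → Adj H x z → Adj H x y ⊎ Adj H y z

multipartite : (Fin n → ℕ) → Graph n
multipartite c = record
  { Adj    = λ u v → c u ≢ c v
  ; adj?   = λ u v → ¬? (c u ℕ.≟ c v)
  ; symm   = ≢-sym
  ; irrefl = λ u≡v cu≢cv → cu≢cv (cong c u≡v)
  }

multipartite-near : (c : Fin n → ℕ) → NearMultipartite (multipartite c)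
multipartite-near c x y z _ _ cx≢cz with c x ℕ.≟ c y
... | yes cx≡cy = inj₂ λ cy≡cz → cx≢cz (trans cx≡cy cy≡cz)
... | no cx≢cy  = inj₁ cx≢cy

sameColour : (Fin n → ℕ) → Fin n → Fin n → Bool
sameColour c i j = does (c i ℕ.≟ c j)

edgeCount-multipartite : (c : Fin n → ℕ) →
  edgeCount (multipartite c) + pairs (sameColour c) ≡ n C 2
edgeCount-multipartite c =
  trans (cong (_+ pairs (sameColour c)) (edgeCount≡pairs (multipartite c))) (pairs-not (sameColour c))

-- Old colours are shifted by `suc`, which keeps `0` fresh for the `b` vertices put in front.
newClass : ∀ b → (Fin n → ℕ) → Fin (b + n) → ℕ
newClass zero    c j       = suc (c j)
newClass (suc b) c zero    = 0
newClass (suc b) c (suc j) = newClass b c j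

count-false : ∀ n → count {n} (λ _ → false) ≡ 0
count-false zero    = refl
count-false (suc n) = count-false n

pairs-newClass : ∀ b (c : Fin n → ℕ) →
                 pairs (sameColour (newClass b c)) ≡ b C 2 + pairs (sameColour c)
pairs-newClass zero    c = refl
pairs-newClass {n} (suc b) c = begin
  count (λ j → does (0 ℕ.≟ newClass b c j)) + pairs (sameColour (newClass b c))
    ≡⟨ cong₂ _+_ (count-class b) (pairs-newClass b c) ⟩
  b + (b C 2 + pairs (sameColour c))   ≡⟨ ℕ.+-assoc b (b C 2) _ ⟨
  b + b C 2 + pairs (sameColour c)     ≡⟨ cong (_+ pairs (sameColour c)) ([1+n]C2≡n+nC2 b) ⟨
  suc b C 2 + pairs (sameColour c)     ∎
  where
  open ≡-Reasoning
  count-class : ∀ b → count (λ j → does (0 ℕ.≟ newClass b c j)) ≡ b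
  count-class zero    = count-false n
  count-class (suc b) = cong suc (count-class b)

pairs-toℕ : ∀ n → pairs (sameColour (toℕ {n})) ≡ 0
pairs-toℕ zero    = refl
pairs-toℕ (suc n) = cong₂ _+_ (count-false n) (pairs-toℕ n)

-- Each class of three vertices accounts for three pairs, and at most two classes of two
-- vertices are needed for the remainder mod 3.
colouring : ∀ n t → 2 + t ≤ n → Σ[ c ∈ (Fin n → ℕ) ] pairs (sameColour c) ≡ t
colouring n 0 _ = toℕ , pairs-toℕ n
colouring (suc (suc n)) 1 (s≤s (s≤s _)) =
  newClass 2 toℕ , trans (pairs-newClass 2 (toℕ {n})) (cong suc (pairs-toℕ n))
-- Two disjoint pairs need four vertices, which dictates the slack in `2 + t ≤ n`. Removing a triple
-- lowers both sides by three and preserves it.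
colouring (suc (suc (suc (suc n)))) 2 (s≤s (s≤s (s≤s (s≤s _)))) =
  newClass 2 (newClass 2 toℕ) ,
  trans (pairs-newClass 2 (newClass 2 (toℕ {n})))
        (cong suc (trans (pairs-newClass 2 (toℕ {n})) (cong suc (pairs-toℕ n))))
colouring (suc (suc (suc n))) (suc (suc (suc t))) (s≤s (s≤s (s≤s 2+t≤n)))
  with c , eq ← colouring n t 2+t≤n =
  newClass 3 c , trans (pairs-newClass 3 c) (cong (3 +_) eq)

nearMultipartite-feasible : Feasible NearMultipartite
nearMultipartite-feasible = feasible-closedUnderIsolated NearMultipartite point isolated dense
  where
  point : NearMultipartite (complete 1)
  point zero y zero _ _ 0≢0 = contradiction refl 0≢0

  isolated : ∀ {n} {H : Graph n} → NearMultipartite H → NearMultipartite (attach 0 H)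
  -- The premise that `y` has a neighbour excludes the new vertex, which is adjacent to neither end
  -- of any edge.
  isolated h _       zero    _       zero     () _
  isolated h _       (suc _) _       zero     () _
  isolated h zero    (suc _) zero    (suc _)  _ ()
  isolated h (suc x) (suc y) (suc z) (suc y′) = h x y z y′

  dense : ∀ n s t → 1 ≤ s → s + t ≡ n →
          Σ[ H ∈ Graph (suc n) ] (NearMultipartite H × edgeCount H ≡ s + n C 2)
  dense n s t 1≤s refl
    -- The `t` missing edges are the monochromatic pairs; `1 ≤ s` provides the bound
    -- `2 + t ≤ suc (s + t)`.
    with c , eq ← colouring (suc (s + t)) t (s≤s (ℕ.+-monoˡ-≤ t 1≤s)) =
    multipartite c , multipartite-near c , +-cancelʳ-≡ t _ _ (begin
      edgeCount (multipartite c) + t                     ≡⟨ cong (edgeCount (multipartite c) +_) eq ⟨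
      edgeCount (multipartite c) + pairs (sameColour c)  ≡⟨ edgeCount-multipartite c ⟩
      suc (s + t) C 2                                    ≡⟨ [1+n]C2≡n+nC2 (s + t) ⟩
      s + t + (s + t) C 2                                ≡⟨ xy∙z≈xz∙y s t _ ⟩
      s + (s + t) C 2 + t                                ∎)
    where
    open ≡-Reasoning
    open import Algebra.Properties.CommutativeSemigroup ℕ.+-commutativeSemigroup using (xy∙z≈xz∙y)

-- An induced copy preserves the edge between `x` and `z`, its non-adjacency to `y`, and some
-- neighbour of `y`. Together these contradict `NearMultipartite`.
nearMultipartite⇒free : (G : Graph n) → NoIsolated G →
  ∀ {x y z} → Adj G x z → ¬ Adj G x y → ¬ Adj G y z →
  ∀ {l} (H : Graph l) → NearMultipartite H → InducedFree G H
nearMultipartite⇒free G nbr {x} {y} {z} xz ¬xy ¬yz H h (S , iso) =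
  [ ¬xy ∘ Equivalence.from (adj e x y) , ¬yz ∘ Equivalence.from (adj e y z) ]′
  (h _ _ _ _ (Equivalence.to (adj e y _) (proj₂ (nbr y))) (Equivalence.to (adj e x z) xz))
  where e = copy⇒↪ G H iso

-- Graphs without isolated vertices, and the characterisation

noIsolated⇒feasible : (2≤n : 2 ≤ n) (G : Graph n) → NoIsolated G →
  ¬ (G ≅ complete n) → ¬ (G ≅ completeMinusEdge 2≤n) → Feasible (InducedFree G)
noIsolated⇒feasible {suc _} 2≤n G nbr ≇complete ≇minusEdge
  with any? (λ v → all? λ x → all? λ y →
         ¬? (x ≟ v) →-dec ¬? (y ≟ v) →-dec ¬? (x ≟ y) →-dec adj? G x y)
... | no noClique = feasible-mono (nearClique⇒free G nbr noClique) nearClique-feasible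
... | yes (v , clique)
  with any? (λ x → ¬? (x ≟ v) ×-dec ¬? (adj? G x v))
... | no allAdj = contradiction
  (↔-id _ , λ a b → mk⇔ (λ Gab a≡b → irrefl G a≡b Gab) (adjacent a b)) ≇complete
  where
  toV : ∀ x → x ≢ v → Adj G x v
  toV x x≢v = decidable-stable (adj? G x v) λ ¬xv → allAdj (x , x≢v , ¬xv)
  adjacent : ∀ a b → a ≢ b → Adj G a b
  adjacent a b a≢b with a ≟ v | b ≟ v
  ... | yes refl | _        = symm G (toV b (≢-sym a≢b))
  ... | no a≢v   | yes refl = toV a a≢v
  ... | no a≢v   | no b≢v   = clique a b a≢v b≢v a≢b
... | yes (x , x≢v , ¬xv)
  with any? (λ y → ¬? (y ≟ v) ×-dec ¬? (y ≟ x) ×-dec ¬? (adj? G v y))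
-- `v` misses two vertices of the clique, so the edge between them together with `v` is the
-- configuration `NearMultipartite` forbids.
... | yes (y , y≢v , y≢x , ¬vy) =
  feasible-mono (nearMultipartite⇒free G nbr (clique x y x≢v y≢v (≢-sym y≢x)) ¬xv ¬vy)
                nearMultipartite-feasible
-- `x` is the only non-neighbour of `v`, so `G` is complete but for the edge between `x` and `v`.
... | no othersAdj = contradiction
  (≅-trans G (deleteEdge (complete _) x v) (completeMinusEdge 2≤n)
           (↔-id _ , λ a b → mk⇔ (forth a b) (λ (a≢b , ¬xv) → back a b a≢b ¬xv))
           (deleteEdge≅completeMinusEdge 2≤n x≢v)) ≇minusEdge
  where
  fromV : ∀ y → y ≢ v → y ≢ x → Adj G v y
  fromV y y≢v y≢x = decidable-stable (adj? G v y) λ ¬vy → othersAdj (y , y≢v , y≢x , ¬vy)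
  forth : ∀ a b → Adj G a b → a ≢ b × ¬ SamePair x v a b
  forth a b Gab = (λ a≡b → irrefl G a≡b Gab) , λ where
    (inj₁ (refl , refl)) → ¬xv Gab
    (inj₂ (refl , refl)) → ¬xv (symm G Gab)
  back : ∀ a b → a ≢ b → ¬ SamePair x v a b → Adj G a b
  back a b a≢b ¬xv with a ≟ v | b ≟ v
  ... | yes refl | _        = fromV b (≢-sym a≢b) λ b≡x → ¬xv (inj₂ (refl , b≡x))
  ... | no a≢v   | yes refl = symm G (fromV a a≢v λ a≡x → ¬xv (inj₁ (a≡x , refl)))
  ... | no a≢v   | no b≢v   = clique a b a≢v b≢v a≢b

-- In the complement `v` is joined to all other vertices, and `2 ≤ n` provides a neighbour for `v`
-- itself.
complement-noIsolated : 2 ≤ n → (G : Graph n) (v : Fin n) → (∀ w → ¬ Adj G v w) →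
                        NoIsolated (complement G)
complement-noIsolated {suc (suc n)} (s≤s (s≤s _)) G v iso u with u ≟ v
... | no u≢v = v , u≢v , iso u ∘ symm G
complement-noIsolated (s≤s (s≤s _)) G zero    iso .zero    | yes refl = suc zero , (λ ()) , iso (suc zero)
complement-noIsolated (s≤s (s≤s _)) G (suc v) iso .(suc v) | yes refl = zero , (λ ()) , iso zero

mainTheorem1 : ∀ (n : ℕ) → 2 ≤ n → (G : Graph n) →
    Feasible (InducedFree G) ⇔
    (∀ (k : ℕ) (2≤k : 2 ≤ k) →
    ¬ (G ≅ complete k) ×
    ¬ (G ≅ completeMinusEdge 2≤k) ×
    ¬ (G ≅ complement (complete k)) ×
    ¬ (G ≅ complement (completeMinusEdge 2≤k)))
mainTheorem1 n 2≤n G = mk⇔ necessary sufficient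
  where
  uncomplement : ∀ {k} (K : Graph k) → G ≅ complement K → complement G ≅ K
  uncomplement K iso = ≅-trans (complement G) (complement (complement K)) K
    (complement-cong G (complement K) iso) (complement-involutive K)

  recomplement : ∀ {k} (K : Graph k) → complement G ≅ K → G ≅ complement K
  recomplement K iso = ≅-trans G (complement (complement G)) (complement K)
    (≅-sym (complement (complement G)) G (complement-involutive G))
    (complement-cong (complement G) K iso)

  necessary : Feasible (InducedFree G) → _
  necessary feas k 2≤k =
    feasible⇒≇complete G 2≤n feas k ,
    feasible⇒≇completeMinusEdge G feas k 2≤k ,
    -- The family of `complement G` is feasible too, so the last two exclusions are the first two
    -- applied to `complement G`.
    feasible⇒≇complete (complement G) 2≤n feas-c k ∘ uncomplement (complete k) ,
    feasible⇒≇completeMinusEdge (complement G) feas-c k 2≤k ∘ uncomplement (completeMinusEdge 2≤k)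
    where feas-c = feasible-complement G feas

  sufficient : (∀ k (2≤k : 2 ≤ k) →
    ¬ (G ≅ complete k) × ¬ (G ≅ completeMinusEdge 2≤k) ×
    ¬ (G ≅ complement (complete k)) × ¬ (G ≅ complement (completeMinusEdge 2≤k))) →
    Feasible (InducedFree G)
  sufficient excluded
    with ≇K , ≇K⁻ , ≇K̄ , ≇K̄⁻ ← excluded n 2≤n
    with all? (λ v → any? (adj? G v))
  ... | yes nbr = noIsolated⇒feasible 2≤n G nbr ≇K ≇K⁻
  ... | no ¬nbr with v , v-isolated ← ¬∀⟶∃¬ n _ (λ v → any? (adj? G v)) ¬nbr =
    feasible-uncomplement G (noIsolated⇒feasible 2≤n (complement G)
      (complement-noIsolated 2≤n G v λ w vw → v-isolated (w , vw))
      (≇K̄ ∘ recomplement (complete n)) (≇K̄⁻ ∘ recomplement (completeMinusEdge 2≤n)))
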